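{- Let $w_1,w_2,w_3$ be any positive integers. Then for every integer $n\ge 0$ and every $y\in\mathbb{Z}_p$, \begin{align*} &\sum_{k+l+m=n}\binom{n}{k,l,m}E_{k,\chi}(w_1y)E_{l,\chi}(w_2y)E_{m,\chi}(w_3y)\,w_{3}^{k}w_{1}^{l}w_{2}^{m}\\ =&\sum_{k+l+m=n}\binom{n}{k,l,m}E_{k,\chi}(w_1y)E_{l,\chi}(w_3y)E_{m,\chi}(w_2y)\,w_{2}^{k}w_{1}^{l}w_{3}^{m}. \end{align*} Here each sum is over all nonnegative integers $k,l,m$ with $k+l+m=n$.
   Context: $p$ is a fixed odd prime, $\mathbb{Z}_p$ is the ring of $p$-adic integers, and $\mathbb{C}_p$ is the completion of an algebraic closure of $\mathbb{Q}_p$. $d$ is a fixed odd positive integer and $\chi$ is a (primitive) Dirichlet character of conductor $d$, with values in $\overline{\mathbb{Q}}$, regarded as $\mathbb{C}_p$-valued through a fixed embedding $\overline{\mathbb{Q}}\to\mathbb{C}_p$; as usual $\chi(a)=0$ when $\gcd(a,d)>1$ (and $\chi\equiv 1$ if $d=1$). The generalized Euler polynomials $E_{n,\chi}(x)$ attached to $\chi$ are the polynomials in $x$ defined by $$\frac{2e^{xt}}{e^{dt}+1}\sum_{a=0}^{d-1}(-1)^a\chi(a)e^{at}=\sum_{n=0}^{\infty}E_{n,\chi}(x)\frac{t^n}{n!}.$$ The multinomial coefficient is $\binom{n}{k,l,m}=\frac{n!}{k!\,l!\,m!}$. -}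

module Defs where

open import Level using (Level; _⊔_; 0ℓ) renaming (suc to lsuc)
open import Function.Base using (_∘_)
open import Data.Nat.Base as ℕ using (ℕ; zero; suc; _∸_; _!; NonZero)
import Data.Nat.Divisibility as ℕᵈ
open import Data.Nat.Properties using (_!≢0; m*n≢0)
open import Data.Integer.Base as ℤ using (ℤ; +_)
import Data.Integer.Divisibility as ℤᵈ
open import Data.Integer.Coprimality using (Coprime)
open import Data.Rational.Base as ℚ using (ℚ; 0ℚ; ½)
import Data.Rational.Properties as ℚ
open import Data.Fin.Base using (zero; toℕ)
open import Data.List.Base as List using (List; []; _∷_)
open import Data.List.Relation.Unary.Any using (Any)
import Data.Vec.Functional as Vector
open import Data.Product.Base using (Σ-syntax; ∃-syntax; _×_; _,_; proj₁)
open import Relation.Nullary.Negation using (¬_)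
open import Relation.Binary.PropositionalEquality.Core using (_≡_)
open import Algebra.Bundles using (CommutativeRing)
open import Algebra.Bundles.Raw using (RawRing)
open import Algebra.Apartness.Bundles using (HeytingCommutativeRing; HeytingField)
open import Algebra.Morphism.Structures using (module RingMorphisms)
import Algebra.Definitions.RawSemiring as RawSemiringOps

------------------------------------------------------------------------
-- Finite sums

module Sums {c ℓ} (R : RawRing c ℓ) where
  open RawRing R
  open RawSemiringOps rawSemiring public using (_^_; sum)

  ∑< : ℕ → (ℕ → Carrier) → Carrier
  ∑< n f = sum {n} (f ∘ toℕ)

  ∑≤ : ℕ → (ℕ → Carrier) → Carrier
  ∑≤ n = ∑< (suc n)

  -- The sum over all triples of natural numbers with k + l + m = n.
  ∑-triples : ℕ → (ℕ → ℕ → ℕ → Carrier) → Carrier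
  ∑-triples n F = ∑≤ n λ k → ∑≤ (n ∸ k) λ l → F k l (n ∸ k ∸ l)

------------------------------------------------------------------------
-- Polynomials in one variable, as coefficient lists starting with the
-- constant term; trailing zeros are allowed.

module Polynomial {c ℓ} (R : RawRing c ℓ) where
  open RawRing R

  Poly : Set c
  Poly = List Carrier

  coeff : Poly → ℕ → Carrier
  coeff []      _       = 0#
  coeff (a ∷ _) zero    = a
  coeff (_ ∷ f) (suc n) = coeff f n

  _+ᵖ_ : Poly → Poly → Poly
  []      +ᵖ g       = g
  f       +ᵖ []      = f
  (a ∷ f) +ᵖ (b ∷ g) = (a + b) ∷ (f +ᵖ g)

  _*ᵖ_ : Poly → Poly → Poly
  []      *ᵖ g = []
  (a ∷ f) *ᵖ g = List.map (a *_) g +ᵖ (0# ∷ (f *ᵖ g))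

  const : Carrier → Poly
  const a = a ∷ []

  X : Poly
  X = 0# ∷ 1# ∷ []

  polynomialRing : RawRing c ℓ
  polynomialRing = record
    { Carrier = Poly
    ; _≈_     = λ f g → ∀ n → coeff f n ≈ coeff g n
    ; _+_     = _+ᵖ_
    ; _*_     = _*ᵖ_
    ; -_      = List.map -_
    ; 0#      = []
    ; 1#      = const 1#
    }

  eval : Poly → Carrier → Carrier
  eval f x = List.foldr (λ a r → a + x * r) 0# f

------------------------------------------------------------------------
-- Formal power series in t, as coefficient sequences; `fromℚ` is the
-- structure map of a ℚ-algebra.

module PowerSeries {c ℓ} (R : RawRing c ℓ) (fromℚ : ℚ → RawRing.Carrier R) where
  open RawRing R
  open Sums R

  Series : Set c
  Series = ℕ → Carrier

  infixl 6 _⊕_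
  infixl 7 _⊗_ _·_

  _⊕_ : Series → Series → Series
  (f ⊕ g) n = f n + g n

  _⊗_ : Series → Series → Series
  (f ⊗ g) n = ∑≤ n λ i → f i * g (n ∸ i)

  _·_ : Carrier → Series → Series
  (a · f) n = a * f n

  one : Series
  one zero    = 1#
  one (suc _) = 0#

  ∑ˢ< : ℕ → (ℕ → Series) → Series
  ∑ˢ< m F n = ∑< m λ a → F a n

  -- e^{at}
  exp : Carrier → Series
  exp a n = fromℚ (ℚ._/_ (+ 1) (n !) {{n !≢0}}) * a ^ n

  -- The multiplicative inverse g of f, where u is an inverse of f 0:
  -- g 0 = u and g (n + 1) = - u ∑_{i ≤ n} f (i + 1) g (n - i).
  -- The vector `inverse-upto f u n` lists g n , … , g 0.
  inverse-upto : Series → Carrier → ∀ n → Vector.Vector Carrier (suc n)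
  inverse-upto f u zero    = λ _ → u
  inverse-upto f u (suc n) =
    (- (u * sum λ i → f (suc (toℕ i)) * inverse-upto f u n i))
      Vector.∷ inverse-upto f u n

  inverse : Series → Carrier → Series
  inverse f u n = inverse-upto f u n zero

------------------------------------------------------------------------
-- Generalized Euler polynomials

module GeneralizedEuler {c ℓ} (K : RawRing c ℓ) (fromℚ : ℚ → RawRing.Carrier K)
                        (d : ℕ) (χ : ℤ → RawRing.Carrier K) where
  open RawRing K
  open Polynomial K
  open Sums K using (_^_)
  open PowerSeries polynomialRing (const ∘ fromℚ)

  private
    nat : ℕ → Poly
    nat n = const (fromℚ (+ n ℚ./ 1))

  -- 2 e^{xt} (e^{dt} + 1)⁻¹ ∑_{0 ≤ a < d} (-1)^a χ(a) e^{at}, a power series in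
  -- t over K[x]; the constant term of e^{dt} + 1 is 2.
  generatingFunction : Series
  generatingFunction =
    nat 2 · exp X
      ⊗ inverse (exp (nat d) ⊕ one) (const (fromℚ ½))
      ⊗ ∑ˢ< d (λ a → const ((- 1#) ^ a * χ (+ a)) · exp (nat a))

  E : ℕ → Poly
  E n = nat (n !) *ᵖ generatingFunction n

multinomial : ℕ → ℕ → ℕ → ℕ → ℚ
multinomial n k l m = ℚ._/_ (+ (n !)) (k ! ℕ.* l ! ℕ.* m !) {{nonZero}}
  where
  nonZero : NonZero (k ! ℕ.* l ! ℕ.* m !)
  nonZero = m*n≢0 (k ! ℕ.* l !) (m !) {{m*n≢0 (k !) (l !) {{k !≢0}} {{l !≢0}}}} {{m !≢0}}

------------------------------------------------------------------------
-- Fields, algebraic closures and completions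

rawRing : ∀ {c ℓ₁ ℓ₂} → HeytingField c ℓ₁ ℓ₂ → RawRing c ℓ₁
rawRing F = CommutativeRing.rawRing
  (HeytingCommutativeRing.commutativeRing (HeytingField.heytingCommutativeRing F))

-- Ring homomorphisms of fields; these preserve invertibility, hence apartness.
record FieldHom {a ℓ₁ ℓ₂ b m₁ m₂} (F : HeytingField a ℓ₁ ℓ₂) (G : HeytingField b m₁ m₂)
              : Set (a ⊔ ℓ₁ ⊔ ℓ₂ ⊔ b ⊔ m₁ ⊔ m₂) where
  open RingMorphisms (rawRing F) (rawRing G)
  field
    ⟦_⟧                : HeytingField.Carrier F → HeytingField.Carrier G
    isRingHomomorphism : IsRingHomomorphism ⟦_⟧

  open IsRingHomomorphism isRingHomomorphism public

record AlgebraicClosure {a ℓ₁ ℓ₂} (F : HeytingField a ℓ₁ ℓ₂) (b m₁ m₂ : Level)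
                      : Set (a ⊔ ℓ₁ ⊔ ℓ₂ ⊔ lsuc (b ⊔ m₁ ⊔ m₂)) where
  field
    field′    : HeytingField b m₁ m₂
    embedding : FieldHom F field′

  private
    module F = HeytingField F
    module L = HeytingField field′
  open FieldHom embedding using (⟦_⟧)
  open Polynomial (rawRing field′) using (eval)

  field
    algebraic : ∀ x → Σ[ f ∈ List F.Carrier ]
      Any (F._# F.0#) f × eval (List.map ⟦_⟧ f) x L.≈ L.0#
    algebraicallyClosed : ∀ a f → Any (L._# L.0#) f → ∃[ x ] eval (a ∷ f) x L.≈ L.0#

-- Non-archimedean valuations with values in ℚ ∪ {∞}, written additively and
-- recorded on the elements apart from 0. This covers ℂₚ, whose value group
-- is ℚ: the absolute value is |x| = p^(- v x).
record Valuation {c ℓ₁ ℓ₂} (F : HeytingField c ℓ₁ ℓ₂) : Set (c ⊔ ℓ₁ ⊔ ℓ₂) where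
  open HeytingField F
  field
    v : ∀ x → x # 0# → ℚ

  -- v x ≥ q, that is |x| ≤ p^(- q); it holds for x = 0.
  infix 4 _≤v_
  _≤v_ : ℚ → Carrier → Set ℓ₂
  q ≤v x = ∀ (x#0 : x # 0#) → q ℚ.≤ v x x#0

  field
    v-cong : ∀ {x y} x#0 y#0 → x ≈ y → v x x#0 ≡ v y y#0
    v-*    : ∀ {x y} x#0 y#0 xy#0 → v (x * y) xy#0 ≡ v x x#0 ℚ.+ v y y#0
    v-+    : ∀ {q x y} → q ≤v x → q ≤v y → q ≤v (x + y)

Extends : ∀ {a ℓ₁ ℓ₂ b m₁ m₂} {F : HeytingField a ℓ₁ ℓ₂} {G : HeytingField b m₁ m₂} →
          FieldHom F G → Valuation F → Valuation G → Set (a ⊔ ℓ₂ ⊔ m₂)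
Extends {F = F} {G} σ vF vG =
  ∀ x (x#0 : x F.# F.0#) (σx#0 : ⟦ x ⟧ G.# G.0#) →
  Valuation.v vG ⟦ x ⟧ σx#0 ≡ Valuation.v vF x x#0
  where
  module F = HeytingField F
  module G = HeytingField G
  open FieldHom σ using (⟦_⟧)

record Completion {a ℓ₁ ℓ₂} (F : HeytingField a ℓ₁ ℓ₂) (vF : Valuation F) (b m₁ m₂ : Level)
                : Set (a ⊔ ℓ₁ ⊔ ℓ₂ ⊔ lsuc (b ⊔ m₁ ⊔ m₂)) where
  field
    field′    : HeytingField b m₁ m₂
    valuation : Valuation field′
    embedding : FieldHom F field′
    extends   : Extends embedding vF valuation

  open HeytingField field′
  open Valuation valuation using (_≤v_)
  open FieldHom embedding using (⟦_⟧)

  field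
    dense    : ∀ x q → ∃[ a ] q ≤v (x - ⟦ a ⟧)
    complete : (s : ℕ → Carrier) →
               (∀ q → ∃[ N ] ∀ i j → N ℕ.≤ i → N ℕ.≤ j → q ≤v (s i - s j)) →
               ∃[ x ] ∀ q → ∃[ N ] ∀ i → N ℕ.≤ i → q ≤v (s i - x)

------------------------------------------------------------------------
-- p-adic numbers

ℚ-field : HeytingField 0ℓ 0ℓ 0ℓ
ℚ-field = ℚ.heytingField

-- v (p^k m) = k for integers m prime to p; with multiplicativity this
-- determines v on all of ℚ.
IsPAdic : ℕ → Valuation ℚ-field → Set
IsPAdic p vℚ = ∀ k m → ¬ p ℕᵈ.∣ m → ∀ nonzero →
  Valuation.v vℚ (+ (p ℕ.^ k ℕ.* m) ℚ./ 1) nonzero ≡ + k ℚ./ 1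

-- ℚ ⊂ ℚₚ ⊂ (an algebraic closure of ℚₚ) ⊂ ℂₚ. The valuations are the unique
-- ones extending the p-adic valuation of ℚ.
record PAdicTower (p : ℕ) (c ℓ₁ ℓ₂ : Level) : Set (lsuc (c ⊔ ℓ₁ ⊔ ℓ₂)) where
  field
    vℚ       : Valuation ℚ-field
    vℚ-padic : IsPAdic p vℚ
    ℚₚ-completion : Completion ℚ-field vℚ c ℓ₁ ℓ₂

  module ℚₚ = Completion ℚₚ-completion

  field
    closure : AlgebraicClosure ℚₚ.field′ c ℓ₁ ℓ₂

  module ℚₚᵃ = AlgebraicClosure closure

  field
    vᵃ         : Valuation ℚₚᵃ.field′
    vᵃ-extends : Extends ℚₚᵃ.embedding ℚₚ.valuation vᵃ
    ℂₚ-completion : Completion ℚₚᵃ.field′ vᵃ c ℓ₁ ℓ₂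

  module ℂₚ = Completion ℂₚ-completion

  ℤₚ : Set (c ⊔ ℓ₂)
  ℤₚ = Σ[ y ∈ HeytingField.Carrier ℚₚ.field′ ] Valuation._≤v_ ℚₚ.valuation 0ℚ y

  ℚₚ→ℂₚ : HeytingField.Carrier ℚₚ.field′ → HeytingField.Carrier ℂₚ.field′
  ℚₚ→ℂₚ = FieldHom.⟦_⟧ ℂₚ.embedding ∘ FieldHom.⟦_⟧ ℚₚᵃ.embedding

  ℚ→ℂₚ : ℚ → HeytingField.Carrier ℂₚ.field′
  ℚ→ℂₚ = ℚₚ→ℂₚ ∘ FieldHom.⟦_⟧ ℚₚ.embedding

  ℕ→ℂₚ : ℕ → HeytingField.Carrier ℂₚ.field′
  ℕ→ℂₚ n = ℚ→ℂₚ (+ n ℚ./ 1)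

  ℤₚ→ℂₚ : ℤₚ → HeytingField.Carrier ℂₚ.field′
  ℤₚ→ℂₚ = ℚₚ→ℂₚ ∘ proj₁

------------------------------------------------------------------------
-- Dirichlet characters

record DirichletCharacter {c ℓ₁ ℓ₂} (F : HeytingField c ℓ₁ ℓ₂) (d : ℕ) : Set (c ⊔ ℓ₁) where
  open HeytingField F
  field
    χ             : ℤ → Carrier
    periodic      : ∀ a b → + d ℤᵈ.∣ (a ℤ.- b) → χ a ≈ χ b
    χ-1           : χ (+ 1) ≈ 1#
    χ-*           : ∀ a b → χ (a ℤ.* b) ≈ χ a * χ b
    χ-non-coprime : ∀ a → ¬ Coprime a (+ d) → χ a ≈ 0#

  InducedModulus : ℕ → Set ℓ₁
  InducedModulus e = ∀ a → Coprime a (+ d) → + e ℤᵈ.∣ (a ℤ.- + 1) → χ a ≈ 1#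

  -- A primitive character modulo d is one of conductor d.
  Primitive : Set ℓ₁
  Primitive = ∀ e → e ℕᵈ.∣ d → InducedModulus e → e ≡ d

{-# OPTIONS --safe #-}

-- With F(x, t) = ∑ₙ Eₙ(x) tⁿ / n! = 2 e^{xt} H(t), where H does not depend on x,
-- both sides are n! times the coefficient of tⁿ in a triple product:
--   F(w₁y, w₃t) F(w₂y, w₁t) F(w₃y, w₂t)   and   F(w₁y, w₂t) F(w₃y, w₁t) F(w₂y, w₃t).
-- Since F(x, wt) = 2 e^{(wx)t} H(wt), both products consist of the same factors
-- 2 e^{w₁w₂yt}, 2 e^{w₁w₃yt}, 2 e^{w₂w₃yt}, H(w₁t), H(w₂t), H(w₃t).

module Submission where

open import Defs
open import Level using (Level)
open import Data.Nat.Base as ℕ using (ℕ; zero; suc; _∸_; _!; NonZero)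
open import Data.Nat.Divisibility using (_∣_)
open import Data.Nat.Primality using (Prime)
open import Data.Nat.Properties using (_!≢0; m*n≢0; m+[n∸m]≡n)
open import Data.Integer.Base as ℤ using (ℤ; +_)
import Data.Integer.Properties as ℤ
open import Data.Rational.Base as ℚ using (ℚ; ½)
import Data.Rational.Properties as ℚ
open import Data.Rational.Unnormalised.Base as ℚᵘ using (mkℚᵘ; *≡*)
import Data.Rational.Unnormalised.Properties as ℚᵘ
open import Data.Fin.Base using (Fin; zero; suc; toℕ)
open import Data.Fin.Properties using (toℕ≤pred[n])
open import Data.List.Base as List using ([]; _∷_)
open import Data.Vec.Functional using (Vector)
open import Relation.Nullary.Negation using (¬_)
open import Relation.Binary.PropositionalEquality.Core as ≡ using (_≡_)
import Relation.Binary.Reasoning.Setoid as SetoidReasoning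
open import Function.Base using (_∘_)
open import Algebra.Apartness.Bundles using (HeytingCommutativeRing; HeytingField)
open import Algebra.Bundles using (CommutativeRing; CommutativeSemigroup)
import Algebra.Properties.CommutativeSemigroup as CommutativeSemigroupProperties
import Algebra.Properties.CommutativeSemiring.Exp as Exp
import Algebra.Properties.Ring as RingProperties
import Algebra.Properties.Semiring.Sum as Sum
import Algebra.Solver.CommutativeMonoid as CommutativeMonoidSolver

-- Products and cancellation of fractions in ℚ.

-- `toℚᵘ` is injective, multiplicative up to `≃`, and a left inverse of normalisation up to `≃`, so
-- the equation may be checked among unnormalised fractions.
fromℚᵘ-homo-* : ∀ p q → ℚ.fromℚᵘ (p ℚᵘ.* q) ≡ ℚ.fromℚᵘ p ℚ.* ℚ.fromℚᵘ q
fromℚᵘ-homo-* p q = ℚ.toℚᵘ-injective (begin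
  ℚ.toℚᵘ (ℚ.fromℚᵘ (p ℚᵘ.* q))                       ≈⟨ ℚ.toℚᵘ-fromℚᵘ (p ℚᵘ.* q) ⟩
  p ℚᵘ.* q                                           ≈⟨ ℚᵘ.*-cong (ℚ.toℚᵘ-fromℚᵘ p) (ℚ.toℚᵘ-fromℚᵘ q) ⟨
  ℚ.toℚᵘ (ℚ.fromℚᵘ p) ℚᵘ.* ℚ.toℚᵘ (ℚ.fromℚᵘ q)       ≈⟨ ℚ.toℚᵘ-homo-* (ℚ.fromℚᵘ p) (ℚ.fromℚᵘ q) ⟨
  ℚ.toℚᵘ (ℚ.fromℚᵘ p ℚ.* ℚ.fromℚᵘ q)                 ∎)
  where open SetoidReasoning ℚᵘ.≃-setoid

/1-homo-* : ∀ a b → + (a ℕ.* b) ℚ./ 1 ≡ (+ a ℚ./ 1) ℚ.* (+ b ℚ./ 1)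
/1-homo-* a b =
  ≡.trans (≡.cong (ℚ._/ 1) (ℤ.pos-* a b)) (fromℚᵘ-homo-* (mkℚᵘ (+ a) 0) (mkℚᵘ (+ b) 0))

/-*-cancel : ∀ a b .{{_ : NonZero b}} → (+ a ℚ./ b) ℚ.* (+ b ℚ./ 1) ≡ + a ℚ./ 1
-- Once the denominator is a successor, each fraction is by definition `fromℚᵘ` of an unnormalised
-- one. Cross-multiplying, the claim becomes (a b) 1 = a (b 1) in ℤ.
/-*-cancel a b@(suc b-1) =
  ≡.trans (≡.sym (fromℚᵘ-homo-* (mkℚᵘ (+ a) b-1) (mkℚᵘ (+ b) 0)))
          (ℚ.fromℚᵘ-cong {mkℚᵘ (+ a) b-1 ℚᵘ.* mkℚᵘ (+ b) 0} {mkℚᵘ (+ a) 0}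
            (*≡* (ℤ.*-assoc (+ a) (+ b) (+ 1))))

-- Convolution of power series and the substitution of wt for t.

module SeriesProperties {c ℓ} (K : CommutativeRing c ℓ) (fromℚ : ℚ → CommutativeRing.Carrier K) where
  open CommutativeRing K hiding (zero) renaming (rawRing to rawK)
  open Sums rawK
  open PowerSeries rawK fromℚ
  open Sum semiring using (sum-cong-≋; ∑-distrib-+; *-distribˡ-sum)
  open Exp commutativeSemiring using (^-homo-*; ^-distrib-*; ^-congˡ)
  open CommutativeSemigroupProperties *-commutativeSemigroup using (interchange; x∙yz≈y∙xz)
  open SetoidReasoning setoid

  ∑<-cong : ∀ n {f g : ℕ → Carrier} → (∀ i → f i ≈ g i) → ∑< n f ≈ ∑< n g
  ∑<-cong n f≈g = sum-cong-≋ {n} (f≈g ∘ toℕ)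

  infix 4 _≋_
  _≋_ : Series → Series → Set ℓ
  f ≋ g = ∀ n → f n ≈ g n

  ⊗-cong : ∀ {f f′ g g′} → f ≋ f′ → g ≋ g′ → f ⊗ g ≋ f′ ⊗ g′
  ⊗-cong f≋f′ g≋g′ n = ∑<-cong (suc n) λ i → *-cong (f≋f′ i) (g≋g′ (n ∸ i))

  -- The sum defining `⊗` unfolds at its first term; commutativity also needs the last term split
  -- off.
  ⊗-sucʳ : ∀ f g n → (f ⊗ g) (suc n) ≈ (f ⊗ (g ∘ suc)) n + f (suc n) * g 0
  ⊗-sucʳ f g zero = begin
    f 0 * g 1 + (f 1 * g 0 + 0#)   ≈⟨ +-congˡ (+-comm _ _) ⟩
    f 0 * g 1 + (0# + f 1 * g 0)   ≈⟨ +-assoc _ _ _ ⟨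
    f 0 * g 1 + 0# + f 1 * g 0     ∎
  ⊗-sucʳ f g (suc n) = trans (+-congˡ (⊗-sucʳ (f ∘ suc) g n)) (sym (+-assoc _ _ _))

  ⊗-comm : ∀ f g → f ⊗ g ≋ g ⊗ f
  ⊗-comm f g zero    = +-congʳ (*-comm _ _)
  -- The first term of `f ⊗ g` is matched with the last term of `g ⊗ f`.
  ⊗-comm f g (suc n) = begin
    f 0 * g (suc n) + ((f ∘ suc) ⊗ g) n   ≈⟨ +-cong (*-comm _ _) (⊗-comm (f ∘ suc) g n) ⟩
    g (suc n) * f 0 + (g ⊗ (f ∘ suc)) n   ≈⟨ +-comm _ _ ⟩
    (g ⊗ (f ∘ suc)) n + g (suc n) * f 0   ≈⟨ ⊗-sucʳ g f n ⟨
    (g ⊗ f) (suc n)                       ∎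

  ⊗-distribʳ-⊕ : ∀ f g h → (g ⊕ h) ⊗ f ≋ (g ⊗ f) ⊕ (h ⊗ f)
  ⊗-distribʳ-⊕ f g h n =
    trans (∑<-cong (suc n) λ i → distribʳ (f (n ∸ i)) (g i) (h i))
          (∑-distrib-+ {suc n} (λ i → g (toℕ i) * f (n ∸ toℕ i)) (λ i → h (toℕ i) * f (n ∸ toℕ i)))

  ·-⊗-assoc : ∀ a f g → (a · f) ⊗ g ≋ a · (f ⊗ g)
  ·-⊗-assoc a f g n =
    trans (∑<-cong (suc n) λ i → *-assoc a (f i) (g (n ∸ i)))
          (sym (*-distribˡ-sum {suc n} a (λ i → f (toℕ i) * g (n ∸ toℕ i))))

  ⊗-assoc : ∀ f g h → (f ⊗ g) ⊗ h ≋ f ⊗ (g ⊗ h)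
  ⊗-assoc f g h zero = begin
    (f 0 * g 0 + 0#) * h 0 + 0#   ≈⟨ +-congʳ (*-congʳ (+-identityʳ _)) ⟩
    f 0 * g 0 * h 0 + 0#          ≈⟨ +-congʳ (*-assoc _ _ _) ⟩
    f 0 * (g 0 * h 0) + 0#        ≈⟨ +-congʳ (*-congˡ (+-identityʳ _)) ⟨
    f 0 * (g 0 * h 0 + 0#) + 0#   ∎
  -- By definition the shifted series `(f ⊗ g) ∘ suc` is `f 0 · g⁺ ⊕ f⁺ ⊗ g`. The induction is on
  -- the degree, with `f` replaced by its tail `f⁺`.
  ⊗-assoc f g h (suc n) = begin
    (f 0 * g 0 + 0#) * h (suc n) + ((f 0 · g⁺ ⊕ f⁺ ⊗ g) ⊗ h) n
      ≈⟨ +-cong (*-congʳ (+-identityʳ _)) (⊗-distribʳ-⊕ h (f 0 · g⁺) (f⁺ ⊗ g) n) ⟩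
    f 0 * g 0 * h (suc n) + (((f 0 · g⁺) ⊗ h) n + ((f⁺ ⊗ g) ⊗ h) n)
      ≈⟨ +-cong (*-assoc _ _ _) (+-cong (·-⊗-assoc (f 0) g⁺ h n) (⊗-assoc f⁺ g h n)) ⟩
    f 0 * (g 0 * h (suc n)) + (f 0 * (g⁺ ⊗ h) n + (f⁺ ⊗ (g ⊗ h)) n)
      ≈⟨ +-assoc _ _ _ ⟨
    f 0 * (g 0 * h (suc n)) + f 0 * (g⁺ ⊗ h) n + (f⁺ ⊗ (g ⊗ h)) n
      ≈⟨ +-congʳ (distribˡ _ _ _) ⟨
    f 0 * (g ⊗ h) (suc n) + (f⁺ ⊗ (g ⊗ h)) n ∎
    where
    f⁺ g⁺ : Series
    f⁺ = f ∘ suc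
    g⁺ = g ∘ suc

  ⊗-commutativeSemigroup : CommutativeSemigroup c ℓ
  ⊗-commutativeSemigroup = record
    { Carrier = Series
    ; _≈_     = _≋_
    ; _∙_     = _⊗_
    ; isCommutativeSemigroup = record
      { isSemigroup = record
        { isMagma = record
          { isEquivalence = record
            { refl  = λ _ → refl
            ; sym   = λ f≋g n → sym (f≋g n)
            ; trans = λ f≋g g≋h n → trans (f≋g n) (g≋h n)
            }
          ; ∙-cong = ⊗-cong
          }
        ; assoc = ⊗-assoc
        }
      ; comm = ⊗-comm
      }
    }

  -- f(wt)
  dilate : Carrier → Series → Series
  dilate w f n = w ^ n * f n

  -- Substituting wt for t is multiplicative because w^n splits as w^k w^(n - k) in the k-th term.
  dilate-⊗ : ∀ w f g → dilate w (f ⊗ g) ≋ dilate w f ⊗ dilate w g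
  dilate-⊗ w f g n =
    trans (*-distribˡ-sum {suc n} (w ^ n) (λ i → f (toℕ i) * g (n ∸ toℕ i))) (sum-cong-≋ {suc n} term)
    where
    -- The index stays in `Fin (suc n)`: since `∸` truncates, the splitting of the exponent uses the
    -- bound k ≤ n.
    term : ∀ (i : Fin (suc n)) →
           w ^ n * (f (toℕ i) * g (n ∸ toℕ i)) ≈ dilate w f (toℕ i) * dilate w g (n ∸ toℕ i)
    term i = begin
      w ^ n * (f k * g (n ∸ k))                ≡⟨ ≡.cong (λ m → w ^ m * (f k * g (n ∸ k))) (m+[n∸m]≡n (toℕ≤pred[n] i)) ⟨
      w ^ (k ℕ.+ (n ∸ k)) * (f k * g (n ∸ k))  ≈⟨ *-congʳ (^-homo-* w k (n ∸ k)) ⟩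
      w ^ k * w ^ (n ∸ k) * (f k * g (n ∸ k))  ≈⟨ interchange _ _ _ _ ⟩
      w ^ k * f k * (w ^ (n ∸ k) * g (n ∸ k))  ∎
      where k = toℕ i

  dilate-· : ∀ w a f → dilate w (a · f) ≋ a · dilate w f
  dilate-· w a f n = x∙yz≈y∙xz _ _ _

  dilate-exp : ∀ w x → dilate w (exp x) ≋ exp (w * x)
  dilate-exp w x n = trans (x∙yz≈y∙xz _ _ _) (*-congˡ (sym (^-distrib-* w x n)))

  exp-cong : ∀ {x y} → x ≈ y → exp x ≋ exp y
  exp-cong x≈y n = *-congˡ (^-congˡ n x≈y)

  -- Sums over triples as iterated convolutions.

  ∑-triples-cong : ∀ n {F G : ℕ → ℕ → ℕ → Carrier} → (∀ k l m → F k l m ≈ G k l m) →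
                   ∑-triples n F ≈ ∑-triples n G
  ∑-triples-cong n F≈G = ∑<-cong (suc n) λ k → ∑<-cong (suc (n ∸ k)) λ l → F≈G k l (n ∸ k ∸ l)

  -- The third index of `∑-triples` is `n ∸ k ∸ l`, exactly the one in `f ⊗ (g ⊗ h)`, so only
  -- constant factors have to be moved out of the two nested sums.
  ∑-triples-⊗ : ∀ a f g h n → ∑-triples n (λ k l m → a * (f k * (g l * h m))) ≈ a * (f ⊗ (g ⊗ h)) n
  ∑-triples-⊗ a f g h n = begin
    (∑≤ n λ k → ∑≤ (n ∸ k) λ l → a * (f k * (g l * h (n ∸ k ∸ l))))
      ≈⟨ ∑<-cong (suc n) inner ⟩
    (∑≤ n λ k → a * (f k * (g ⊗ h) (n ∸ k)))
      ≈⟨ *-distribˡ-sum {suc n} a (λ k → f (toℕ k) * (g ⊗ h) (n ∸ toℕ k)) ⟨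
    a * (f ⊗ (g ⊗ h)) n ∎
    where
    inner : ∀ k → (∑≤ (n ∸ k) λ l → a * (f k * (g l * h (n ∸ k ∸ l)))) ≈ a * (f k * (g ⊗ h) (n ∸ k))
    inner k = begin
      (∑≤ (n ∸ k) λ l → a * (f k * (g l * h (n ∸ k ∸ l))))
        ≈⟨ *-distribˡ-sum {suc (n ∸ k)} a (λ l → f k * (g (toℕ l) * h (n ∸ k ∸ toℕ l))) ⟨
      a * (∑≤ (n ∸ k) λ l → f k * (g l * h (n ∸ k ∸ l)))
        ≈⟨ *-congˡ (*-distribˡ-sum {suc (n ∸ k)} (f k) (λ l → g (toℕ l) * h (n ∸ k ∸ toℕ l))) ⟨
      a * (f k * (g ⊗ h) (n ∸ k)) ∎

-- Evaluation of polynomials, and of series with polynomial coefficients.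

module Evaluation {c ℓ} (K : CommutativeRing c ℓ) (fromℚ : ℚ → CommutativeRing.Carrier K)
                  (x : CommutativeRing.Carrier K) where
  open CommutativeRing K hiding (zero) renaming (rawRing to rawK)
  open Polynomial rawK
  open CommutativeSemigroupProperties
    +-commutativeSemigroup using (interchange)
  open CommutativeSemigroupProperties *-commutativeSemigroup using (x∙yz≈y∙xz)
  open RingProperties ring using (-‿distribʳ-*; -‿+-comm; -0#≈0#)
  open SetoidReasoning setoid

  eval-const : ∀ a → eval (const a) x ≈ a
  eval-const a = trans (+-congˡ (zeroʳ x)) (+-identityʳ a)

  eval-X : eval X x ≈ x
  eval-X = trans (+-identityˡ _) (trans (*-congˡ (eval-const 1#)) (*-identityʳ x))

  eval-+ : ∀ f g → eval (f +ᵖ g) x ≈ eval f x + eval g x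
  eval-+ []      g       = sym (+-identityˡ _)
  eval-+ (a ∷ f) []      = sym (+-identityʳ _)
  eval-+ (a ∷ f) (b ∷ g) = begin
    a + b + x * eval (f +ᵖ g) x             ≈⟨ +-congˡ (*-congˡ (eval-+ f g)) ⟩
    a + b + x * (eval f x + eval g x)       ≈⟨ +-congˡ (distribˡ _ _ _) ⟩
    a + b + (x * eval f x + x * eval g x)   ≈⟨ interchange _ _ _ _ ⟩
    a + x * eval f x + (b + x * eval g x)   ∎

  eval-scale : ∀ a f → eval (List.map (a *_) f) x ≈ a * eval f x
  eval-scale a []      = sym (zeroʳ a)
  eval-scale a (b ∷ f) = begin
    a * b + x * eval (List.map (a *_) f) x   ≈⟨ +-congˡ (*-congˡ (eval-scale a f)) ⟩
    a * b + x * (a * eval f x)               ≈⟨ +-congˡ (x∙yz≈y∙xz _ _ _) ⟩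
    a * b + a * (x * eval f x)               ≈⟨ distribˡ _ _ _ ⟨
    a * (b + x * eval f x)                   ∎

  eval-* : ∀ f g → eval (f *ᵖ g) x ≈ eval f x * eval g x
  eval-* []      g = sym (zeroˡ _)
  eval-* (a ∷ f) g = begin
    eval (List.map (a *_) g +ᵖ (0# ∷ (f *ᵖ g))) x     ≈⟨ eval-+ (List.map (a *_) g) (0# ∷ (f *ᵖ g)) ⟩
    eval (List.map (a *_) g) x + (0# + x * eval (f *ᵖ g) x)
      ≈⟨ +-cong (eval-scale a g) (trans (+-identityˡ _) (*-congˡ (eval-* f g))) ⟩
    a * eval g x + x * (eval f x * eval g x)          ≈⟨ +-congˡ (*-assoc _ _ _) ⟨
    a * eval g x + x * eval f x * eval g x            ≈⟨ distribʳ _ _ _ ⟨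
    (a + x * eval f x) * eval g x                     ∎

  eval-neg : ∀ f → eval (List.map -_ f) x ≈ - eval f x
  eval-neg []      = sym -0#≈0#
  eval-neg (a ∷ f) = begin
    - a + x * eval (List.map -_ f) x   ≈⟨ +-congˡ (*-congˡ (eval-neg f)) ⟩
    - a + x * - eval f x               ≈⟨ +-congˡ (-‿distribʳ-* _ _) ⟨
    - a + - (x * eval f x)             ≈⟨ -‿+-comm _ _ ⟩
    - (a + x * eval f x)               ∎

  private
    module K where
      open Sums rawK public
      open PowerSeries rawK fromℚ public
    module K[x] where
      open Sums polynomialRing public
      open PowerSeries polynomialRing (const ∘ fromℚ) public

  -- A record rather than a definition, so that f and a can be inferred from f ⇝ a.
  infix 4 _⇝_ _⇝ˢ_
  record _⇝_ (f : Poly) (a : Carrier) : Set ℓ where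
    constructor evaluates
    field eval≈ : eval f x ≈ a
  open _⇝_ public

  -- A logical relation between series over K[x] and series over K. Every construction used in the
  -- generating function preserves it, so the value of the generating function is found by following
  -- how it is built.
  _⇝ˢ_ : K[x].Series → K.Series → Set ℓ
  F ⇝ˢ f = ∀ n → F n ⇝ f n

  const-⇝ : ∀ a → const a ⇝ a
  const-⇝ a = evaluates (eval-const a)

  X-⇝ : X ⇝ x
  X-⇝ = evaluates eval-X

  +-⇝ : ∀ {f g a b} → f ⇝ a → g ⇝ b → f +ᵖ g ⇝ a + b
  +-⇝ {f} {g} f⇝a g⇝b = evaluates (trans (eval-+ f g) (+-cong (eval≈ f⇝a) (eval≈ g⇝b)))

  *-⇝ : ∀ {f g a b} → f ⇝ a → g ⇝ b → f *ᵖ g ⇝ a * b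
  *-⇝ {f} {g} f⇝a g⇝b = evaluates (trans (eval-* f g) (*-cong (eval≈ f⇝a) (eval≈ g⇝b)))

  neg-⇝ : ∀ {f a} → f ⇝ a → List.map -_ f ⇝ - a
  neg-⇝ {f} f⇝a = evaluates (trans (eval-neg f) (-‿cong (eval≈ f⇝a)))

  ^-⇝ : ∀ {f a} → f ⇝ a → ∀ n → f K[x].^ n ⇝ a K.^ n
  ^-⇝ f⇝a zero    = const-⇝ 1#
  ^-⇝ f⇝a (suc n) = *-⇝ f⇝a (^-⇝ f⇝a n)

  sum-⇝ : ∀ {n} {f : Vector Poly n} {a : Vector Carrier n} →
          (∀ i → f i ⇝ a i) → K[x].sum f ⇝ K.sum a
  sum-⇝ {zero}  f⇝a = evaluates refl
  sum-⇝ {suc n} f⇝a = +-⇝ (f⇝a zero) (sum-⇝ (f⇝a ∘ suc))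

  exp-⇝ : ∀ {f a} → f ⇝ a → K[x].exp f ⇝ˢ K.exp a
  exp-⇝ f⇝a n = *-⇝ (const-⇝ _) (^-⇝ f⇝a n)

  ·-⇝ : ∀ {f a F g} → f ⇝ a → F ⇝ˢ g → f K[x].· F ⇝ˢ a K.· g
  ·-⇝ f⇝a F⇝g n = *-⇝ f⇝a (F⇝g n)

  ⊗-⇝ : ∀ {F G f g} → F ⇝ˢ f → G ⇝ˢ g → F K[x].⊗ G ⇝ˢ f K.⊗ g
  ⊗-⇝ F⇝f G⇝g n = sum-⇝ {suc n} λ i → *-⇝ (F⇝f (toℕ i)) (G⇝g (n ∸ toℕ i))

  ⊕-⇝ : ∀ {F G f g} → F ⇝ˢ f → G ⇝ˢ g → F K[x].⊕ G ⇝ˢ f K.⊕ g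
  ⊕-⇝ F⇝f G⇝g n = +-⇝ (F⇝f n) (G⇝g n)

  one-⇝ : K[x].one ⇝ˢ K.one
  one-⇝ zero    = const-⇝ 1#
  one-⇝ (suc n) = evaluates refl

  ∑ˢ<-⇝ : ∀ n {F : ℕ → K[x].Series} {f : ℕ → K.Series} →
          (∀ i → F i ⇝ˢ f i) → K[x].∑ˢ< n F ⇝ˢ K.∑ˢ< n f
  ∑ˢ<-⇝ n F⇝f m = sum-⇝ {n} λ i → F⇝f (toℕ i) m

  -- Proved for all entries of the vector at once, since each new head depends on all earlier
  -- coefficients.
  inverse-upto-⇝ : ∀ {F f u v} → F ⇝ˢ f → u ⇝ v →
                   ∀ n i → K[x].inverse-upto F u n i ⇝ K.inverse-upto f v n i
  inverse-upto-⇝ F⇝f u⇝v zero    i       = u⇝v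
  inverse-upto-⇝ F⇝f u⇝v (suc n) zero    =
    neg-⇝ (*-⇝ u⇝v (sum-⇝ {suc n} λ i → *-⇝ (F⇝f (suc (toℕ i))) (inverse-upto-⇝ F⇝f u⇝v n i)))
  inverse-upto-⇝ F⇝f u⇝v (suc n) (suc i) = inverse-upto-⇝ F⇝f u⇝v n i

  inverse-⇝ : ∀ {F f u v} → F ⇝ˢ f → u ⇝ v → K[x].inverse F u ⇝ˢ K.inverse f v
  inverse-⇝ F⇝f u⇝v n = inverse-upto-⇝ F⇝f u⇝v n zero

-- Triple sums of Euler polynomials and their symmetry.

module EulerSums {c ℓ} (K : CommutativeRing c ℓ) (fromℚ : ℚ → CommutativeRing.Carrier K)
                 (fromℚ-homo-* : ∀ p q → CommutativeRing._≈_ K (fromℚ (p ℚ.* q))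
                                           (CommutativeRing._*_ K (fromℚ p) (fromℚ q)))
                 (d : ℕ) (χ : ℤ → CommutativeRing.Carrier K) where
  open CommutativeRing K hiding (zero) renaming (rawRing to rawK)
  open Polynomial rawK using (eval; const)
  open Sums rawK
  open PowerSeries rawK fromℚ
  open SeriesProperties K fromℚ
  open GeneralizedEuler rawK fromℚ d χ
  open CommutativeSemigroupProperties *-commutativeSemigroup using (x∙yz≈y∙xz)

  nat : ℕ → Carrier
  nat n = fromℚ (+ n ℚ./ 1)

  2exp : Carrier → Series
  2exp x = nat 2 · exp x

  [e^dt+1]⁻¹ : Series
  [e^dt+1]⁻¹ = inverse (exp (nat d) ⊕ one) (fromℚ ½)

  characterSum : Series
  characterSum = ∑ˢ< d λ a → ((- 1#) ^ a * χ (+ a)) · exp (nat a)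

  -- H(t)
  cofactor : Series
  cofactor = [e^dt+1]⁻¹ ⊗ characterSum

  -- The coefficients of e^{dt} + 1 and of the character sum are constant polynomials,
  -- so evaluation at x only affects e^{xt}.
  eval-generatingFunction : ∀ x n → eval (generatingFunction n) x ≈ (2exp x ⊗ cofactor) n
  eval-generatingFunction x n = trans
    (eval≈ (⊗-⇝
      (⊗-⇝ (·-⇝ (const-⇝ (nat 2)) (exp-⇝ X-⇝))
           (inverse-⇝ (⊕-⇝ (exp-⇝ (const-⇝ (nat d))) one-⇝) (const-⇝ (fromℚ ½))))
      (∑ˢ<-⇝ d λ a → ·-⇝ (const-⇝ ((- 1#) ^ a * χ (+ a))) (exp-⇝ (const-⇝ (nat a))))
      n))
    (⊗-assoc (2exp x) [e^dt+1]⁻¹ characterSum n)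
    where open Evaluation K fromℚ x

  eval-E : ∀ x n → eval (E n) x ≈ nat (n !) * (2exp x ⊗ cofactor) n
  eval-E x n = trans (eval-* (const (nat (n !))) (generatingFunction n))
                     (*-cong (eval-const (nat (n !))) (eval-generatingFunction x n))
    where open Evaluation K fromℚ x

  nat-homo-* : ∀ a b → nat (a ℕ.* b) ≈ nat a * nat b
  nat-homo-* a b = trans (reflexive (≡.cong fromℚ (/1-homo-* a b))) (fromℚ-homo-* _ _)

  -- The three factorials coming from `E k`, `E l`, `E m` cancel the denominator of the multinomial
  -- coefficient. The cancellation takes place in ℚ and is carried to K by multiplicativity of
  -- `fromℚ`.
  multinomial-! : ∀ n k l m →
    fromℚ (multinomial n k l m) * (nat (k !) * nat (l !) * nat (m !)) ≈ nat (n !)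
  multinomial-! n k l m = begin
    fromℚ (multinomial n k l m) * (nat (k !) * nat (l !) * nat (m !))
      ≈⟨ *-congˡ (trans (nat-homo-* (k ! ℕ.* l !) (m !)) (*-congʳ (nat-homo-* (k !) (l !)))) ⟨
    fromℚ (multinomial n k l m) * nat (k ! ℕ.* l ! ℕ.* m !)
      ≈⟨ fromℚ-homo-* (multinomial n k l m) (+ (k ! ℕ.* l ! ℕ.* m !) ℚ./ 1) ⟨
    fromℚ (multinomial n k l m ℚ.* (+ (k ! ℕ.* l ! ℕ.* m !) ℚ./ 1))
      ≡⟨ ≡.cong fromℚ (/-*-cancel (n !) (k ! ℕ.* l ! ℕ.* m !)) ⟩
    nat (n !) ∎
    where
    open SetoidReasoning setoid
    instance
      k!*l!*m!≢0 : NonZero (k ! ℕ.* l ! ℕ.* m !)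
      k!*l!*m!≢0 = m*n≢0 (k ! ℕ.* l !) (m !) {{m*n≢0 (k !) (l !) {{k !≢0}} {{l !≢0}}}} {{m !≢0}}

  -- The common shape of both sides of the theorem: the evaluation points and the scales are
  -- independent parameters, listed in the order of k, l, m.
  eulerSum : (x₁ x₂ x₃ u₁ u₂ u₃ : Carrier) → ℕ → Carrier
  eulerSum x₁ x₂ x₃ u₁ u₂ u₃ n = ∑-triples n λ k l m →
    fromℚ (multinomial n k l m)
      * eval (E k) x₁ * eval (E l) x₂ * eval (E m) x₃
      * u₁ ^ k * u₂ ^ l * u₃ ^ m

  -- The powers of the scales turn into dilations, and the factorials combine with the multinomial
  -- coefficient into n!, which does not depend on k, l, m. What remains is a coefficient of a
  -- triple product.
  eulerSum-⊗ : ∀ x₁ x₂ x₃ u₁ u₂ u₃ n →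
    eulerSum x₁ x₂ x₃ u₁ u₂ u₃ n ≈
    nat (n !) * (dilate u₁ (2exp x₁ ⊗ cofactor)
                   ⊗ (dilate u₂ (2exp x₂ ⊗ cofactor) ⊗ dilate u₃ (2exp x₃ ⊗ cofactor))) n
  eulerSum-⊗ x₁ x₂ x₃ u₁ u₂ u₃ n = trans
    (∑-triples-cong n λ k l m → begin
      fromℚ (multinomial n k l m) * eval (E k) x₁ * eval (E l) x₂ * eval (E m) x₃
        * u₁ ^ k * u₂ ^ l * u₃ ^ m
        ≈⟨ *-congʳ (*-congʳ (*-congʳ (*-cong (*-cong (*-congˡ (eval-E x₁ k)) (eval-E x₂ l)) (eval-E x₃ m)))) ⟩
      fromℚ (multinomial n k l m)
        * (nat (k !) * f₁ k) * (nat (l !) * f₂ l) * (nat (m !) * f₃ m)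
        * u₁ ^ k * u₂ ^ l * u₃ ^ m
        -- Collects the factorials next to the multinomial coefficient and puts each power beside
        -- the series coefficient that it dilates.
        ≈⟨ solve 10 (λ c k! a l! b m! e u v w →
             ((((((c ∙ (k! ∙ a)) ∙ (l! ∙ b)) ∙ (m! ∙ e)) ∙ u) ∙ v) ∙ w)
             ⊜ ((c ∙ ((k! ∙ l!) ∙ m!)) ∙ ((u ∙ a) ∙ ((v ∙ b) ∙ (w ∙ e))))) refl
             _ _ _ _ _ _ _ _ _ _ ⟩
      fromℚ (multinomial n k l m) * (nat (k !) * nat (l !) * nat (m !))
        * (u₁ ^ k * f₁ k * (u₂ ^ l * f₂ l * (u₃ ^ m * f₃ m)))
        ≈⟨ *-congʳ (multinomial-! n k l m) ⟩
      nat (n !) * (dilate u₁ f₁ k * (dilate u₂ f₂ l * dilate u₃ f₃ m)) ∎)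
    (∑-triples-⊗ (nat (n !)) (dilate u₁ f₁) (dilate u₂ f₂) (dilate u₃ f₃) n)
    where
    open SetoidReasoning setoid
    open CommutativeMonoidSolver *-commutativeMonoid using (solve; _⊜_) renaming (_⊕_ to _∙_)
    f₁ f₂ f₃ : Series
    f₁ = 2exp x₁ ⊗ cofactor
    f₂ = 2exp x₂ ⊗ cofactor
    f₃ = 2exp x₃ ⊗ cofactor

  -- The exponent `z` is kept apart from `w * x` so that the factors of both products can be brought
  -- to literally the same exponentials.
  dilate-2exp⊗cofactor : ∀ w {x z} → w * x ≈ z →
                         dilate w (2exp x ⊗ cofactor) ≋ 2exp z ⊗ dilate w cofactor
  dilate-2exp⊗cofactor w {x} {z} wx≈z n = trans
    (dilate-⊗ w (2exp x) cofactor n)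
    (⊗-cong {g = dilate w cofactor}
      (λ k → trans (dilate-· w (nat 2) (exp x) k) (*-congˡ (trans (dilate-exp w x k) (exp-cong wx≈z k))))
      (λ _ → refl) n)

  eulerSum-symmetric : ∀ w₁ w₂ w₃ y n →
    eulerSum (w₁ * y) (w₂ * y) (w₃ * y) w₃ w₁ w₂ n ≈
    eulerSum (w₁ * y) (w₃ * y) (w₂ * y) w₂ w₁ w₃ n
  eulerSum-symmetric w₁ w₂ w₃ y n = trans
    (eulerSum-⊗ _ _ _ w₃ w₁ w₂ n)
    -- Both sides are now n! times an n-th coefficient, so it is enough to identify the two triple
    -- products.
    (trans (*-congˡ (products n)) (sym (eulerSum-⊗ _ _ _ w₂ w₁ w₃ n)))
    where
    module S = CommutativeSemigroup ⊗-commutativeSemigroup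
    open CommutativeSemigroupProperties ⊗-commutativeSemigroup
      using (interchange) renaming (x∙yz≈y∙xz to f⊗gh≈g⊗fh; x∙yz≈z∙xy to f⊗gh≈h⊗fg)
    open SetoidReasoning S.setoid

    e₁₂ e₁₃ e₂₃ h₁ h₂ h₃ : Series
    e₁₂ = 2exp (w₁ * (w₂ * y))
    e₁₃ = 2exp (w₁ * (w₃ * y))
    e₂₃ = 2exp (w₂ * (w₃ * y))
    h₁ = dilate w₁ cofactor
    h₂ = dilate w₂ cofactor
    h₃ = dilate w₃ cofactor

    -- Separates the exponentials from the dilated cofactors, so that each group can be permuted on
    -- its own.
    gather : ∀ f f′ g g′ h h′ → (f ⊗ f′) ⊗ ((g ⊗ g′) ⊗ (h ⊗ h′)) ≋ (f ⊗ (g ⊗ h)) ⊗ (f′ ⊗ (g′ ⊗ h′))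
    gather f f′ g g′ h h′ =
      S.trans (S.∙-congˡ {x = f ⊗ f′} (interchange g g′ h h′)) (interchange f f′ (g ⊗ h) (g′ ⊗ h′))

    products :
      dilate w₃ (2exp (w₁ * y) ⊗ cofactor)
        ⊗ (dilate w₁ (2exp (w₂ * y) ⊗ cofactor) ⊗ dilate w₂ (2exp (w₃ * y) ⊗ cofactor))
      ≋
      dilate w₂ (2exp (w₁ * y) ⊗ cofactor)
        ⊗ (dilate w₁ (2exp (w₃ * y) ⊗ cofactor) ⊗ dilate w₃ (2exp (w₂ * y) ⊗ cofactor))
    products = begin
      dilate w₃ (2exp (w₁ * y) ⊗ cofactor)
        ⊗ (dilate w₁ (2exp (w₂ * y) ⊗ cofactor) ⊗ dilate w₂ (2exp (w₃ * y) ⊗ cofactor))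
        ≈⟨ S.∙-cong (dilate-2exp⊗cofactor w₃ (x∙yz≈y∙xz w₃ w₁ y))
             (S.∙-cong (dilate-2exp⊗cofactor w₁ refl) (dilate-2exp⊗cofactor w₂ refl)) ⟩
      (e₁₃ ⊗ h₃) ⊗ ((e₁₂ ⊗ h₁) ⊗ (e₂₃ ⊗ h₂))
        ≈⟨ gather e₁₃ h₃ e₁₂ h₁ e₂₃ h₂ ⟩
      (e₁₃ ⊗ (e₁₂ ⊗ e₂₃)) ⊗ (h₃ ⊗ (h₁ ⊗ h₂))
        -- The orders are chosen for the regrouping that follows, which must pair `e₁₂` with `h₂`,
        -- `e₁₃` with `h₁` and `e₂₃` with `h₃`, as on the other side.
        ≈⟨ S.∙-cong (f⊗gh≈g⊗fh e₁₃ e₁₂ e₂₃)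
             (S.trans (f⊗gh≈h⊗fg h₃ h₁ h₂) (S.∙-congˡ {x = h₂} (S.comm h₃ h₁))) ⟩
      (e₁₂ ⊗ (e₁₃ ⊗ e₂₃)) ⊗ (h₂ ⊗ (h₁ ⊗ h₃))
        ≈⟨ gather e₁₂ h₂ e₁₃ h₁ e₂₃ h₃ ⟨
      (e₁₂ ⊗ h₂) ⊗ ((e₁₃ ⊗ h₁) ⊗ (e₂₃ ⊗ h₃))
        ≈⟨ S.∙-cong (dilate-2exp⊗cofactor w₂ (x∙yz≈y∙xz w₂ w₁ y))
             (S.∙-cong (dilate-2exp⊗cofactor w₁ refl) (dilate-2exp⊗cofactor w₃ (x∙yz≈y∙xz w₃ w₂ y))) ⟨
      dilate w₂ (2exp (w₁ * y) ⊗ cofactor)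
        ⊗ (dilate w₁ (2exp (w₃ * y) ⊗ cofactor) ⊗ dilate w₃ (2exp (w₂ * y) ⊗ cofactor)) ∎

theorem4p7 :
  ∀ {c ℓ₁ ℓ₂ b m₁ m₂ : Level}
  (p : ℕ) → Prime p → ¬ 2 ∣ p →
  (tower : PAdicTower p c ℓ₁ ℓ₂)
  (let open PAdicTower tower) →
  (ℚᵃ : AlgebraicClosure ℚ-field b m₁ m₂)
  (σ : FieldHom (AlgebraicClosure.field′ ℚᵃ) ℂₚ.field′) →
  (d : ℕ) → .{{_ : NonZero d}} → ¬ 2 ∣ d →
  (χ : DirichletCharacter (AlgebraicClosure.field′ ℚᵃ) d) →
  DirichletCharacter.Primitive χ →
  (w₁ w₂ w₃ : ℕ) → .{{_ : NonZero w₁}} → .{{_ : NonZero w₂}} → .{{_ : NonZero w₃}} →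
  (n : ℕ) (y : ℤₚ) →
  let open HeytingField ℂₚ.field′ using (_≈_)
      open HeytingField ℂₚ.field′ using (_*_)
      open Sums (rawRing ℂₚ.field′) using (_^_)
      open Sums (rawRing ℂₚ.field′) using (∑-triples)
      open Polynomial (rawRing ℂₚ.field′) using (eval)
      open GeneralizedEuler (rawRing ℂₚ.field′) ℚ→ℂₚ d (FieldHom.⟦_⟧ σ ∘ DirichletCharacter.χ χ) using (E)
      w₁′ = ℕ→ℂₚ w₁
      w₂′ = ℕ→ℂₚ w₂
      w₃′ = ℕ→ℂₚ w₃
      y′ = ℤₚ→ℂₚ y
  in
  ∑-triples n (λ k l m →
    ℚ→ℂₚ (multinomial n k l m)
      * eval (E k) (w₁′ * y′) * eval (E l) (w₂′ * y′) * eval (E m) (w₃′ * y′)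
      * w₃′ ^ k * w₁′ ^ l * w₂′ ^ m)
  ≈
  ∑-triples n (λ k l m →
    ℚ→ℂₚ (multinomial n k l m)
      * eval (E k) (w₁′ * y′) * eval (E l) (w₃′ * y′) * eval (E m) (w₂′ * y′)
      * w₂′ ^ k * w₁′ ^ l * w₃′ ^ m)
theorem4p7 p _ _ tower ℚᵃ σ d _ χ _ w₁ w₂ w₃ n y =
  -- Both sums of the statement are `eulerSum` unfolded, at the images of the weights and of `y` in
  -- ℂₚ.
  eulerSum-symmetric (ℕ→ℂₚ w₁) (ℕ→ℂₚ w₂) (ℕ→ℂₚ w₃) (ℤₚ→ℂₚ y) n
  where
  open PAdicTower tower
  open HeytingField ℂₚ.field′ using (_≈_; _*_; trans; heytingCommutativeRing)
  module ι₁ = FieldHom ℚₚ.embedding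
  module ι₂ = FieldHom ℚₚᵃ.embedding
  module ι₃ = FieldHom ℂₚ.embedding

  -- The map is the composite of the three embeddings of the tower, so products are carried up one
  -- stage at a time.
  ℚ→ℂₚ-homo-* : ∀ q r → ℚ→ℂₚ (q ℚ.* r) ≈ ℚ→ℂₚ q * ℚ→ℂₚ r
  ℚ→ℂₚ-homo-* q r =
    trans (ι₃.⟦⟧-cong (ι₂.⟦⟧-cong (ι₁.*-homo q r)))
          (trans (ι₃.⟦⟧-cong (ι₂.*-homo _ _)) (ι₃.*-homo _ _))

  open EulerSums (HeytingCommutativeRing.commutativeRing heytingCommutativeRing) ℚ→ℂₚ ℚ→ℂₚ-homo-*
                 d (FieldHom.⟦_⟧ σ ∘ DirichletCharacter.χ χ)
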